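{- Let $\mathcal{F}$ be the folded component (with vertex set $\{0,1,\dots,\mathrm{ord}(\ell)-1\}$ and edges as specified in the context). For all $v\in V(\mathcal{F})$ such that $2\nmid v$, $$\mathrm{ecc}(v)=\begin{cases}\frac12(v+1) & \text{if } v\ge \frac12(\mathrm{ord}(\ell)-1),\\ \frac12(\mathrm{ord}(\ell)-v) & \text{if } v<\frac12(\mathrm{ord}(\ell)-1).\end{cases}$$
   Context: Let $p$ be a prime with $p\equiv 71$ or $119\pmod{120}$, let $\ell=2$, and let $\mathrm{ord}(\ell)$ be the order, in the ideal class group of $\mathbb{Q}(\sqrt{ -p})$, of a prime ideal above $2$; it is an odd integer $\ge 3$. The folded component $\mathcal{F}$ (a component of the supersingular $2$-isogeny graph over $\mathbb{F}_p$ after identifying curves up to $\overline{\mathbb{F}_p}$-isomorphism, regarded as a simple undirected graph) is labelled so that $V(\mathcal{F})=\{0,1,\dots,\mathrm{ord}(\ell)-1\}$ and $$E(\mathcal{F})=\{\{2k-1,2k+1\}: 1\le k\le \tfrac12(\mathrm{ord}(\ell)-3)\}\cup\{\{2k+1,2k+2\}:0\le k\le \tfrac12(\mathrm{ord}(\ell)-3)\}\cup\{\{0,1\}\}.$$ The eccentricity $\mathrm{ecc}(v)$ is the maximum graph distance from $v$ to any vertex of $\mathcal{F}$. -}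

module Defs where

open import Algebra.Bundles using (CommutativeRing)
open import Data.Fin.Base using (Fin; toℕ)
open import Data.Integer.Base as ℤ using (ℤ; +_; 0ℤ; 1ℤ)
import Data.Integer.Properties as ℤ
import Data.Integer.Tactic.RingSolver as ℤ-Solver
open import Data.Nat.Base as ℕ using (ℕ; zero; suc; _≤_; s≤s)
open import Data.Nat.DivMod using (_/_)
import Data.Nat.Properties as ℕ
open import Data.Product.Base using (_×_; _,_; ∃-syntax)
open import Data.Sum.Base using (_⊎_; inj₁; inj₂)
open import Level using (Level; 0ℓ; _⊔_) renaming (suc to lsuc)
open import Relation.Binary.Construct.Closure.Symmetric as Sym using (SymClosure; fwd; bwd)
open import Relation.Binary.Core using (Rel)
open import Relation.Binary.Definitions using (Symmetric)
open import Relation.Binary.PropositionalEquality.Core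
  using (_≡_; refl; trans; cong₂)
open import Relation.Binary.PropositionalEquality.Properties using (isEquivalence)
open import Relation.Nullary.Negation.Core using (¬_)
open import Relation.Unary using (Pred; _∈_; _≐_)

module Ideals {c ℓ : Level} (R : CommutativeRing c ℓ) where

  open CommutativeRing R hiding (zero)
    renaming (refl to ≈-refl; sym to ≈-sym; trans to ≈-trans)

  record Ideal : Set (lsuc (c ⊔ ℓ)) where
    field
      carrier  : Pred Carrier (c ⊔ ℓ)
      respects : ∀ {x y} → x ≈ y → x ∈ carrier → y ∈ carrier
      0∈       : 0# ∈ carrier
      +-closed : ∀ {x y} → x ∈ carrier → y ∈ carrier → x + y ∈ carrier
      *-absorb : ∀ r {x} → x ∈ carrier → r * x ∈ carrier

  open Ideal public

  infix 4 _∈ᴵ_ _≐ᴵ_ _~_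
  infixl 7 _·_
  infixr 8 _^ᴵ_

  _∈ᴵ_ : Carrier → Ideal → Set (c ⊔ ℓ)
  x ∈ᴵ I = x ∈ carrier I

  _≐ᴵ_ : Rel Ideal (c ⊔ ℓ)
  I ≐ᴵ J = carrier I ≐ carrier J

  ⟨_⟩ : Carrier → Ideal
  ⟨ a ⟩ = record
    { carrier  = λ x → ∃[ r ] x ≈ r * a
    ; respects = λ { x≈y (r , eq) → r , ≈-trans (≈-sym x≈y) eq }
    ; 0∈       = 0# , ≈-sym (zeroˡ a)
    ; +-closed = λ { (r , eq) (s , eq′) →
        r + s , ≈-trans (+-cong eq eq′) (≈-sym (distribʳ a r s)) }
    ; *-absorb = λ { s (r , eq) →
        s * r , ≈-trans (*-cong ≈-refl eq) (≈-sym (*-assoc s r a)) }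
    }

  data ProductCarrier (I J : Ideal) : Pred Carrier (c ⊔ ℓ) where
    prod : ∀ {a b} → a ∈ᴵ I → b ∈ᴵ J → ProductCarrier I J (a * b)
    zero : ProductCarrier I J 0#
    plus : ∀ {x y} → ProductCarrier I J x → ProductCarrier I J y →
           ProductCarrier I J (x + y)
    resp : ∀ {x y} → x ≈ y → ProductCarrier I J x → ProductCarrier I J y

  _·_ : Ideal → Ideal → Ideal
  I · J = record
    { carrier  = ProductCarrier I J
    ; respects = resp
    ; 0∈       = zero
    ; +-closed = plus
    ; *-absorb = absorb
    }
    where
    absorb : ∀ r {x} → ProductCarrier I J x → ProductCarrier I J (r * x)
    absorb r (prod {a} {b} a∈I b∈J) =
      resp (*-assoc r a b) (prod (*-absorb I r a∈I) b∈J)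
    absorb r zero           = resp (≈-sym (zeroʳ r)) zero
    absorb r (plus x y)     = resp (≈-sym (distribˡ r _ _)) (plus (absorb r x) (absorb r y))
    absorb r (resp x≈y x)   = resp (*-cong ≈-refl x≈y) (absorb r x)

  _^ᴵ_ : Ideal → ℕ → Ideal
  I ^ᴵ zero  = ⟨ 1# ⟩
  I ^ᴵ suc n = I · (I ^ᴵ n)

  record IsPrimeIdeal (P : Ideal) : Set (c ⊔ ℓ) where
    field
      proper : ¬ (1# ∈ᴵ P)
      prime  : ∀ a b → a * b ∈ᴵ P → a ∈ᴵ P ⊎ b ∈ᴵ P

  -- For nonzero ideals of a Dedekind domain: equality of classes in the
  -- ideal class group.
  _~_ : Rel Ideal (c ⊔ ℓ)
  I ~ J = ∃[ α ] ∃[ β ] ¬ (α ≈ 0#) × ¬ (β ≈ 0#) × (⟨ α ⟩ · I ≐ᴵ ⟨ β ⟩ · J)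

  record IsClassOrder (I : Ideal) (n : ℕ) : Set (c ⊔ ℓ) where
    field
      positive : 1 ≤ n
      trivial  : I ^ᴵ n ~ ⟨ 1# ⟩
      minimal  : ∀ k → 1 ≤ k → I ^ᴵ k ~ ⟨ 1# ⟩ → n ≤ k

-- For a prime p ≡ 3 (mod 4), the ring of integers of ℚ(√-p) is ℤ[ω] with
-- ω = (1 + √-p)/2, so that ω² = ω - (p + 1)/4; the pair (x , y) stands for
-- x + y ω.

ℤ[ω] : Set
ℤ[ω] = ℤ × ℤ

module _ (p : ℕ) where

  private
    N : ℤ
    N = + ((p ℕ.+ 1) / 4)

  infixl 6 _+ω_
  infixl 7 _*ω_

  _+ω_ : ℤ[ω] → ℤ[ω] → ℤ[ω]
  (a , b) +ω (c , d) = a ℤ.+ c , b ℤ.+ d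

  _*ω_ : ℤ[ω] → ℤ[ω] → ℤ[ω]
  (a , b) *ω (c , d) =
    a ℤ.* c ℤ.- N ℤ.* (b ℤ.* d) , a ℤ.* d ℤ.+ b ℤ.* c ℤ.+ b ℤ.* d

  -ω_ : ℤ[ω] → ℤ[ω]
  -ω (a , b) = ℤ.- a , ℤ.- b

  private
    *-assoc₁ : ∀ n a b c d e f →
      (a ℤ.* c ℤ.- n ℤ.* (b ℤ.* d)) ℤ.* e ℤ.- n ℤ.* ((a ℤ.* d ℤ.+ b ℤ.* c ℤ.+ b ℤ.* d) ℤ.* f)
      ≡ a ℤ.* (c ℤ.* e ℤ.- n ℤ.* (d ℤ.* f)) ℤ.- n ℤ.* (b ℤ.* (c ℤ.* f ℤ.+ d ℤ.* e ℤ.+ d ℤ.* f))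
    *-assoc₁ = ℤ-Solver.solve-∀

    *-assoc₂ : ∀ n a b c d e f →
      (a ℤ.* c ℤ.- n ℤ.* (b ℤ.* d)) ℤ.* f ℤ.+ (a ℤ.* d ℤ.+ b ℤ.* c ℤ.+ b ℤ.* d) ℤ.* e
        ℤ.+ (a ℤ.* d ℤ.+ b ℤ.* c ℤ.+ b ℤ.* d) ℤ.* f
      ≡ a ℤ.* (c ℤ.* f ℤ.+ d ℤ.* e ℤ.+ d ℤ.* f) ℤ.+ b ℤ.* (c ℤ.* e ℤ.- n ℤ.* (d ℤ.* f))
        ℤ.+ b ℤ.* (c ℤ.* f ℤ.+ d ℤ.* e ℤ.+ d ℤ.* f)
    *-assoc₂ = ℤ-Solver.solve-∀

    *-comm₁ : ∀ n a b c d →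
      a ℤ.* c ℤ.- n ℤ.* (b ℤ.* d) ≡ c ℤ.* a ℤ.- n ℤ.* (d ℤ.* b)
    *-comm₁ = ℤ-Solver.solve-∀

    *-comm₂ : ∀ a b c d →
      a ℤ.* d ℤ.+ b ℤ.* c ℤ.+ b ℤ.* d ≡ c ℤ.* b ℤ.+ d ℤ.* a ℤ.+ d ℤ.* b
    *-comm₂ = ℤ-Solver.solve-∀

    *-comm : ∀ x y → x *ω y ≡ y *ω x
    *-comm (a , b) (c , d) = cong₂ _,_ (*-comm₁ N a b c d) (*-comm₂ a b c d)

    *-identityˡ₁ : ∀ n a b → 1ℤ ℤ.* a ℤ.- n ℤ.* (0ℤ ℤ.* b) ≡ a
    *-identityˡ₁ = ℤ-Solver.solve-∀

    *-identityˡ₂ : ∀ a b → 1ℤ ℤ.* b ℤ.+ 0ℤ ℤ.* a ℤ.+ 0ℤ ℤ.* b ≡ b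
    *-identityˡ₂ = ℤ-Solver.solve-∀

    *-identityˡ : ∀ x → (1ℤ , 0ℤ) *ω x ≡ x
    *-identityˡ (a , b) = cong₂ _,_ (*-identityˡ₁ N a b) (*-identityˡ₂ a b)

    distribˡ₁ : ∀ n a b c d e f →
      a ℤ.* (c ℤ.+ e) ℤ.- n ℤ.* (b ℤ.* (d ℤ.+ f))
      ≡ (a ℤ.* c ℤ.- n ℤ.* (b ℤ.* d)) ℤ.+ (a ℤ.* e ℤ.- n ℤ.* (b ℤ.* f))
    distribˡ₁ = ℤ-Solver.solve-∀

    distribˡ₂ : ∀ a b c d e f →
      a ℤ.* (d ℤ.+ f) ℤ.+ b ℤ.* (c ℤ.+ e) ℤ.+ b ℤ.* (d ℤ.+ f)
      ≡ (a ℤ.* d ℤ.+ b ℤ.* c ℤ.+ b ℤ.* d) ℤ.+ (a ℤ.* f ℤ.+ b ℤ.* e ℤ.+ b ℤ.* f)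
    distribˡ₂ = ℤ-Solver.solve-∀

    distribˡ : ∀ x y z → x *ω (y +ω z) ≡ (x *ω y) +ω (x *ω z)
    distribˡ (a , b) (c , d) (e , f) =
      cong₂ _,_ (distribˡ₁ N a b c d e f) (distribˡ₂ a b c d e f)

  𝓞 : CommutativeRing 0ℓ 0ℓ
  𝓞 = record
    { Carrier = ℤ[ω]
    ; _≈_     = _≡_
    ; _+_     = _+ω_
    ; _*_     = _*ω_
    ; -_      = -ω_
    ; 0#      = 0ℤ , 0ℤ
    ; 1#      = 1ℤ , 0ℤ
    ; isCommutativeRing = record
      { isRing = record
        { +-isAbelianGroup = record
          { isGroup = record
            { isMonoid = record
              { isSemigroup = record
                { isMagma = record
                  { isEquivalence = isEquivalence
                  ; ∙-cong        = cong₂ _+ω_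
                  }
                ; assoc = λ { (a , b) (c , d) (e , f) →
                    cong₂ _,_ (ℤ.+-assoc a c e) (ℤ.+-assoc b d f) }
                }
              ; identity =
                  (λ { (a , b) → cong₂ _,_ (ℤ.+-identityˡ a) (ℤ.+-identityˡ b) })
                , (λ { (a , b) → cong₂ _,_ (ℤ.+-identityʳ a) (ℤ.+-identityʳ b) })
              }
            ; inverse =
                (λ { (a , b) → cong₂ _,_ (ℤ.+-inverseˡ a) (ℤ.+-inverseˡ b) })
              , (λ { (a , b) → cong₂ _,_ (ℤ.+-inverseʳ a) (ℤ.+-inverseʳ b) })
            ; ⁻¹-cong = λ { refl → refl }
            }
          ; comm = λ { (a , b) (c , d) → cong₂ _,_ (ℤ.+-comm a c) (ℤ.+-comm b d) }
          }
        ; *-cong  = cong₂ _*ω_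
        ; *-assoc = λ { (a , b) (c , d) (e , f) →
            cong₂ _,_ (*-assoc₁ N a b c d e f) (*-assoc₂ N a b c d e f) }
        ; *-identity =
            *-identityˡ , (λ x → trans (*-comm x (1ℤ , 0ℤ)) (*-identityˡ x))
        ; distrib =
            distribˡ
          , (λ x y z → trans (*-comm (y +ω z) x)
              (trans (distribˡ x y z) (cong₂ _+ω_ (*-comm x y) (*-comm x z))))
        }
      ; *-comm = *-comm
      }
    }

record SimpleGraph (V : Set) : Set₁ where
  field
    Adj   : Rel V 0ℓ
    symm  : Symmetric Adj
    irrefl : ∀ v → ¬ Adj v v

module _ {V : Set} (G : SimpleGraph V) where

  open SimpleGraph G

  data Walk : V → V → ℕ → Set where
    []  : ∀ {u} → Walk u u 0
    _∷_ : ∀ {u v w n} → Adj u v → Walk v w n → Walk u w (suc n)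

  record IsDistance (u v : V) (d : ℕ) : Set where
    field
      walk     : Walk u v d
      shortest : ∀ n → Walk u v n → d ≤ n

  -- The first field also forces every vertex to be at finite distance from v.
  record IsEccentricity (v : V) (e : ℕ) : Set where
    field
      bound    : ∀ w → ∃[ d ] IsDistance v w d × d ≤ e
      attained : ∃[ w ] IsDistance v w e

-- An unordered edge {a , b} is listed here in one of its orientations.
-- All halves are exact for odd m ≥ 3.
FoldedEdge : ℕ → Rel ℕ 0ℓ
FoldedEdge m a b =
    (∃[ k ] 1 ≤ k × k ≤ (m ℕ.∸ 3) / 2 × a ≡ 2 ℕ.* k ℕ.∸ 1 × b ≡ 2 ℕ.* k ℕ.+ 1)
  ⊎ (∃[ k ] k ≤ (m ℕ.∸ 3) / 2 × a ≡ 2 ℕ.* k ℕ.+ 1 × b ≡ 2 ℕ.* k ℕ.+ 2)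
  ⊎ (a ≡ 0 × b ≡ 1)

FoldedEdge-< : ∀ {m a b} → FoldedEdge m a b → a ℕ.< b
FoldedEdge-< (inj₁ (k , _ , _ , refl , refl)) =
  ℕ.≤-<-trans (ℕ.m∸n≤m (2 ℕ.* k) 1) (ℕ.m<m+n (2 ℕ.* k) ℕ.z<s)
FoldedEdge-< (inj₂ (inj₁ (k , _ , refl , refl))) = ℕ.+-monoʳ-< (2 ℕ.* k) (s≤s ℕ.z<s)
FoldedEdge-< (inj₂ (inj₂ (refl , refl))) = ℕ.z<s

foldedComponent : (m : ℕ) → SimpleGraph (Fin m)
foldedComponent m = record
  { Adj    = λ u v → SymClosure (FoldedEdge m) (toℕ u) (toℕ v)
  ; symm   = Sym.symmetric (FoldedEdge m)
  ; irrefl = λ { v (fwd e) → ℕ.<-irrefl refl (FoldedEdge-< {m} e)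
               ; v (bwd e) → ℕ.<-irrefl refl (FoldedEdge-< {m} e) }
  }

{-# OPTIONS --safe #-}

-- For ord = 3 + 2n the folded component is a caterpillar: the odd vertices
-- 1 + 2k (k ≤ n) form a path, 2 + 2k is a leaf hanging from 1 + 2k, and 0 is a
-- further leaf hanging from 1.  From 1 + 2j, the distance to a vertex is thus
-- |j - k|, plus one for a leaf; the farthest vertex is 0 or 2 + 2n, at distance
-- 1 + max (j , n - j).
module Submission where

open import Defs
open import Data.Fin.Base using (Fin; zero; toℕ; fromℕ<)
open import Data.Fin.Properties using (toℕ<n; toℕ-fromℕ<; toℕ-injective)
open import Data.Integer.Base using (+_)
open import Data.Nat.Base
  using (ℕ; zero; suc; pred; _+_; _*_; _∸_; _≤_; _<_; _≥_; z≤n; s≤s; s≤s⁻¹; s<s⁻¹; ∣_-_∣)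
open import Data.Nat.DivMod using (_/_; _%_; m*n/n≡m)
open import Data.Nat.Divisibility using (_∣_; divides)
open import Data.Nat.Primality using (Prime)
open import Data.Nat.Properties
open import Data.Product.Base using (_×_; _,_; ∃-syntax; proj₁; proj₂)
open import Data.Sum.Base using (_⊎_; inj₁; inj₂)
open import Relation.Binary.Construct.Closure.Symmetric using (fwd; bwd)
open import Relation.Binary.PropositionalEquality
open import Relation.Nullary.Negation using (¬_; contradiction)

-- Walks in a simple graph.

module _ {V : Set} (G : SimpleGraph V) where

  open SimpleGraph G

  snoc : ∀ {u v w n} → Walk G u v n → Adj v w → Walk G u w (suc n)
  snoc []       e = e ∷ []
  snoc (d ∷ ds) e = d ∷ snoc ds e

  reverse : ∀ {u v n} → Walk G u v n → Walk G v u n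
  reverse []       = []
  reverse (e ∷ es) = snoc (reverse es) (symm e)

  -- Each step raises `f` by at most one. When `f` vanishes at the start, this bounds the length of
  -- every walk from below, which yields minimality of distances.
  walk-lipschitz : (f : V → ℕ) → (∀ {u v} → Adj u v → f v ≤ suc (f u)) →
    ∀ {u v n} → Walk G u v n → f v ≤ n + f u
  walk-lipschitz f lip [] = ≤-refl
  walk-lipschitz f lip {u} {v} (_∷_ {v = x} {n = n} e es) = begin
    f v             ≤⟨ walk-lipschitz f lip es ⟩
    n + f x         ≤⟨ +-monoʳ-≤ n (lip e) ⟩
    n + suc (f u)   ≡⟨ +-suc n (f u) ⟩
    suc n + f u     ∎
    where open ≤-Reasoning

-- Vertices and edges of the infinite caterpillar.

data Vertex : ℕ → Set where
  origin : Vertex 0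
  spine  : ∀ k → Vertex (1 + k * 2)
  leaf   : ∀ k → Vertex (2 + k * 2)

vertex : ∀ w → Vertex w
vertex 0 = origin
vertex 1 = spine 0
vertex 2 = leaf 0
-- Since `suc k * 2` reduces to `2 + k * 2`, raising k turns the view of w + 1 into that of w + 3;
-- `origin` cannot occur at a successor.
vertex (suc (suc (suc w))) with vertex (suc w)
... | spine k = spine (suc k)
... | leaf k  = leaf (suc k)

odd⇒1+k*2 : ∀ {m} → ¬ (2 ∣ m) → ∃[ k ] m ≡ 1 + k * 2
odd⇒1+k*2 {m} 2∤m with vertex m
... | origin  = contradiction (divides 0 refl) 2∤m
... | spine k = k , refl
... | leaf k  = contradiction (divides (suc k) refl) 2∤m

-- `FoldedEdge` without its bounds on k, so that the Lipschitz estimate can be proved for all n at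
-- once.
data Edge : ℕ → ℕ → Set where
  along : ∀ k → Edge (1 + k * 2) (3 + k * 2)
  hang  : ∀ k → Edge (1 + k * 2) (2 + k * 2)
  root  : Edge 0 1

c+k*2≡2*k+c : ∀ c k → c + k * 2 ≡ 2 * k + c
c+k*2≡2*k+c c k = trans (+-comm c (k * 2)) (cong (_+ c) (*-comm k 2))

FoldedEdge⇒Edge : ∀ {m a b} → FoldedEdge m a b → Edge a b
-- Spine edges are numbered from 1 in `FoldedEdge` and from 0 in `along`.
FoldedEdge⇒Edge (inj₁ (suc k , _ , _ , a≡ , b≡)) =
  subst₂ Edge (trans (cong pred (*-comm (suc k) 2)) (sym a≡))
    (trans (c+k*2≡2*k+c 1 (suc k)) (sym b≡)) (along k)
FoldedEdge⇒Edge (inj₂ (inj₁ (k , _ , a≡ , b≡))) =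
  subst₂ Edge (trans (c+k*2≡2*k+c 1 k) (sym a≡))
    (trans (c+k*2≡2*k+c 2 k) (sym b≡)) (hang k)
FoldedEdge⇒Edge (inj₂ (inj₂ (refl , refl))) = root

-- The candidate distance function and its Lipschitz property.

position : ℕ → ℕ
-- The vertices 0 and 2 both hang from 1, hence three base values.
position 0 = 0
position 1 = 0
position 2 = 0
position (suc (suc (suc w))) = suc (position (suc w))

height : ℕ → ℕ
height 0 = 1
height 1 = 0
height (suc (suc w)) = height w

position-spine : ∀ k → position (1 + k * 2) ≡ k
position-spine zero    = refl
position-spine (suc k) = cong suc (position-spine k)

position-leaf : ∀ k → position (2 + k * 2) ≡ k
position-leaf zero    = refl
position-leaf (suc k) = cong suc (position-leaf k)

height-spine : ∀ k → height (1 + k * 2) ≡ 0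
height-spine zero    = refl
height-spine (suc k) = height-spine k

height-leaf : ∀ k → height (2 + k * 2) ≡ 1
height-leaf zero    = refl
height-leaf (suc k) = height-leaf k

distanceFrom : ℕ → ℕ → ℕ
distanceFrom j w = height w + ∣ j - position w ∣

distanceFrom-spine : ∀ j k → distanceFrom j (1 + k * 2) ≡ ∣ j - k ∣
distanceFrom-spine j k =
  cong₂ (λ h q → h + ∣ j - q ∣) (height-spine k) (position-spine k)

distanceFrom-leaf : ∀ j k → distanceFrom j (2 + k * 2) ≡ suc ∣ j - k ∣
distanceFrom-leaf j k =
  cong₂ (λ h q → h + ∣ j - q ∣) (height-leaf k) (position-leaf k)

distanceFrom-origin : ∀ j → distanceFrom j 0 ≡ suc j
distanceFrom-origin j = cong suc (∣-∣-identityʳ j)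

∣m-1+m∣≡1 : ∀ m → ∣ m - suc m ∣ ≡ 1
∣m-1+m∣≡1 zero    = refl
∣m-1+m∣≡1 (suc m) = ∣m-1+m∣≡1 m

∣-∣-sucʳ-≤ : ∀ j k → ∣ j - suc k ∣ ≤ suc ∣ j - k ∣
∣-∣-sucʳ-≤ j k = begin
  ∣ j - suc k ∣              ≤⟨ ∣-∣-triangle j k (suc k) ⟩
  ∣ j - k ∣ + ∣ k - suc k ∣  ≡⟨ cong (λ d → ∣ j - k ∣ + d) (∣m-1+m∣≡1 k) ⟩
  ∣ j - k ∣ + 1              ≡⟨ +-comm ∣ j - k ∣ 1 ⟩
  suc ∣ j - k ∣              ∎
  where open ≤-Reasoning

∣-∣-≤-sucʳ : ∀ j k → ∣ j - k ∣ ≤ suc ∣ j - suc k ∣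
∣-∣-≤-sucʳ j k = begin
  ∣ j - k ∣                      ≤⟨ ∣-∣-triangle j (suc k) k ⟩
  ∣ j - suc k ∣ + ∣ suc k - k ∣  ≡⟨ cong (λ d → ∣ j - suc k ∣ + d)
                                        (trans (∣-∣-comm (suc k) k) (∣m-1+m∣≡1 k)) ⟩
  ∣ j - suc k ∣ + 1              ≡⟨ +-comm ∣ j - suc k ∣ 1 ⟩
  suc ∣ j - suc k ∣              ∎
  where open ≤-Reasoning

-- Whichever of m and n is larger, the absolute difference is a truncated subtraction, bounded by
-- one of the two hypotheses.
∣m-n∣≤o : ∀ {m n o} → m ≤ n + o → n ≤ m + o → ∣ m - n ∣ ≤ o
∣m-n∣≤o {m} {n} m≤n+o n≤m+o with ≤-total m n
... | inj₁ m≤n = subst (_≤ _) (sym (m≤n⇒∣m-n∣≡n∸m m≤n)) (m≤n+o⇒m∸n≤o n m n≤m+o)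
... | inj₂ n≤m = subst (_≤ _) (sym (m≤n⇒∣n-m∣≡n∸m n≤m)) (m≤n+o⇒m∸n≤o m n m≤n+o)

-- A spine edge shifts the position by one and keeps the height; a pendant edge does the reverse.
-- Both orientations are treated because adjacency is the symmetric closure.
Edge-lipschitz : ∀ j {a b} → Edge a b →
  distanceFrom j b ≤ suc (distanceFrom j a) × distanceFrom j a ≤ suc (distanceFrom j b)
Edge-lipschitz j (along k)
  rewrite distanceFrom-spine j k | distanceFrom-spine j (suc k) =
  ∣-∣-sucʳ-≤ j k , ∣-∣-≤-sucʳ j k
Edge-lipschitz j (hang k)
  rewrite distanceFrom-spine j k | distanceFrom-leaf j k =
  ≤-refl , m≤n⇒m≤1+n (n≤1+n _)
Edge-lipschitz j root = m≤n⇒m≤1+n (n≤1+n _) , ≤-refl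

-- Distances and eccentricities for order 3 + 2n.

module _ (n : ℕ) where

  private
    m : ℕ
    m = 3 + n * 2

    G : SimpleGraph (Fin m)
    G = foldedComponent m

  open SimpleGraph G using (Adj)

  private
    ≤n⇒≤half : ∀ {k} → k ≤ n → k ≤ (m ∸ 3) / 2
    ≤n⇒≤half = subst (_ ≤_) (sym (m*n/n≡m n 2))

  along-edge : ∀ {k} → suc k ≤ n → FoldedEdge m (1 + k * 2) (3 + k * 2)
  along-edge {k} k<n = inj₁
    (suc k , s≤s z≤n , ≤n⇒≤half k<n , cong pred (*-comm (suc k) 2) , c+k*2≡2*k+c 1 (suc k))

  hang-edge : ∀ {k} → k ≤ n → FoldedEdge m (1 + k * 2) (2 + k * 2)
  hang-edge {k} k≤n = inj₂ (inj₁
    (k , ≤n⇒≤half k≤n , c+k*2≡2*k+c 1 k , c+k*2≡2*k+c 2 k))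

  spine-≤ : ∀ (w : Fin m) k → toℕ w ≡ 1 + k * 2 → k ≤ n
  spine-≤ w k w≡ = s≤s⁻¹ (*-cancelʳ-< 2 k (suc n) (s<s⁻¹ (subst (_< m) w≡ (toℕ<n w))))

  leaf-≤ : ∀ (w : Fin m) k → toℕ w ≡ 2 + k * 2 → k ≤ n
  leaf-≤ w k w≡ =
    *-cancelʳ-≤ k n 2 (s≤s⁻¹ (s≤s⁻¹ (s≤s⁻¹ (subst (_< m) w≡ (toℕ<n w)))))

  spine-< : ∀ {k} → k ≤ n → 1 + k * 2 < m
  spine-< k≤n = s≤s (s≤s (m≤n⇒m≤1+n (*-monoˡ-≤ 2 k≤n)))

  -- Induction on the number of spine steps towards 1; every intermediate vertex lies in `Fin m`
  -- because it is below u.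
  descent : ∀ d {j} {u w : Fin m} →
    toℕ u ≡ 1 + (d + j) * 2 → toℕ w ≡ 1 + j * 2 → Walk G u w d
  descent zero u≡ w≡ =
    subst (λ x → Walk G _ x 0) (toℕ-injective (trans u≡ (sym w≡))) []
  descent (suc d) {j} {u} u≡ w≡ =
    bwd (subst₂ (FoldedEdge m) (sym x≡) (sym u≡) (along-edge 1+d+j≤n)) ∷ descent d x≡ w≡
    where
    1+d+j≤n : suc (d + j) ≤ n
    1+d+j≤n = spine-≤ u (suc (d + j)) u≡
    x≡ = toℕ-fromℕ< (spine-< {d + j} (<⇒≤ 1+d+j≤n))

  spine-walk : ∀ j k {u w : Fin m} →
    toℕ u ≡ 1 + j * 2 → toℕ w ≡ 1 + k * 2 → Walk G u w ∣ j - k ∣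
  spine-walk j k u≡ w≡ with ≤-total j k
  -- An ascending walk is a reversed descent.
  ... | inj₁ j≤k = subst (Walk G _ _) (sym (m≤n⇒∣m-n∣≡n∸m j≤k))
    (reverse G (descent (k ∸ j) (trans w≡ (cong (λ i → 1 + i * 2) (sym (m∸n+n≡m j≤k)))) u≡))
  ... | inj₂ k≤j = subst (Walk G _ _) (sym (m≤n⇒∣n-m∣≡n∸m k≤j))
    (descent (j ∸ k) (trans u≡ (cong (λ i → 1 + i * 2) (sym (m∸n+n≡m k≤j)))) w≡)

  module _ (v : Fin m) (j : ℕ) (v≡ : toℕ v ≡ 1 + j * 2) where

    -- Serves both the leaves and 0: walk along the spine to the point of attachment, then take one
    -- more edge.
    pendant-walk : ∀ {k w} → k ≤ n → (∀ {x} → toℕ x ≡ 1 + k * 2 → Adj x w) →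
      Walk G v w (suc ∣ j - k ∣)
    pendant-walk {k} k≤n e = snoc G (spine-walk j k v≡ x≡) (e x≡)
      where x≡ = toℕ-fromℕ< (spine-< k≤n)

    walk-from : ∀ w → Walk G v w (distanceFrom j (toℕ w))
    walk-from w with toℕ w in w≡ | vertex (toℕ w)
    ... | .0 | origin = pendant-walk z≤n λ x≡ →
      bwd (subst₂ (FoldedEdge m) (sym w≡) (sym x≡) (inj₂ (inj₂ (refl , refl))))
    ... | .(1 + k * 2) | spine k =
      subst (Walk G v w) (sym (distanceFrom-spine j k)) (spine-walk j k v≡ w≡)
    ... | .(2 + k * 2) | leaf k =
      subst (Walk G v w) (sym (distanceFrom-leaf j k))
        (pendant-walk k≤n λ x≡ →
          fwd (subst₂ (FoldedEdge m) (sym x≡) (sym w≡) (hang-edge k≤n)))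
      where k≤n = leaf-≤ w k w≡

    distanceFrom-lipschitz : ∀ {u w} → Adj u w →
      distanceFrom j (toℕ w) ≤ suc (distanceFrom j (toℕ u))
    distanceFrom-lipschitz (fwd e) = proj₁ (Edge-lipschitz j (FoldedEdge⇒Edge {m} e))
    distanceFrom-lipschitz (bwd e) = proj₂ (Edge-lipschitz j (FoldedEdge⇒Edge {m} e))

    distanceFrom-self : distanceFrom j (toℕ v) ≡ 0
    distanceFrom-self =
      trans (cong (distanceFrom j) v≡) (trans (distanceFrom-spine j j) (∣n-n∣≡0 j))

    -- The explicit walk gives the upper bound; the Lipschitz function, zero at v, gives the lower
    -- one.
    isDistance : ∀ w → IsDistance G v w (distanceFrom j (toℕ w))
    isDistance w = record
      { walk     = walk-from w
      ; shortest = λ l p → subst (distanceFrom j (toℕ w) ≤_)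
          (trans (cong (λ x → l + x) distanceFrom-self) (+-identityʳ l))
          (walk-lipschitz G (λ x → distanceFrom j (toℕ x)) distanceFrom-lipschitz p)
      }

    -- Here c bounds the distance from v to both ends of the spine; a pendant edge adds one.
    module _ {c : ℕ} (j≤c : j ≤ c) (n≤j+c : n ≤ j + c) where

      ∣j-k∣≤c : ∀ {k} → k ≤ n → ∣ j - k ∣ ≤ c
      ∣j-k∣≤c {k} k≤n = ∣m-n∣≤o (≤-trans j≤c (m≤n+m c k)) (≤-trans k≤n n≤j+c)

      distanceFrom-≤ : ∀ (w : Fin m) → distanceFrom j (toℕ w) ≤ suc c
      distanceFrom-≤ w with toℕ w in w≡ | vertex (toℕ w)
      ... | .0 | origin = s≤s (∣j-k∣≤c z≤n)
      ... | .(1 + k * 2) | spine k =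
        subst (_≤ suc c) (sym (distanceFrom-spine j k)) (m≤n⇒m≤1+n (∣j-k∣≤c (spine-≤ w k w≡)))
      ... | .(2 + k * 2) | leaf k =
        subst (_≤ suc c) (sym (distanceFrom-leaf j k)) (s≤s (∣j-k∣≤c (leaf-≤ w k w≡)))

      isEccentricity : ∀ w → distanceFrom j (toℕ w) ≡ suc c → IsEccentricity G v (suc c)
      isEccentricity w eq = record
        { bound    = λ x → distanceFrom j (toℕ x) , isDistance x , distanceFrom-≤ x
        ; attained = w , subst (IsDistance G v w) eq (isDistance w)
        }

    eccentricity-high : n ≤ j + j → IsEccentricity G v (suc j)
    eccentricity-high n≤j+j =
      -- The end 1 of the spine is at least as far as the other, so 0 is a farthest vertex.
      isEccentricity ≤-refl n≤j+j zero (distanceFrom-origin j)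

    eccentricity-low : j + j ≤ n → IsEccentricity G v (suc (n ∸ j))
    eccentricity-low j+j≤n =
      -- Now the upper end is at least as far, and its leaf 2 + 2n is a farthest vertex.
      isEccentricity (m+n≤o⇒m≤o∸n j j+j≤n) (m≤n+m∸n n j) (fromℕ< last<m) (begin
        distanceFrom j (toℕ (fromℕ< last<m))  ≡⟨ cong (distanceFrom j) (toℕ-fromℕ< last<m) ⟩
        distanceFrom j (2 + n * 2)            ≡⟨ distanceFrom-leaf j n ⟩
        suc ∣ j - n ∣                         ≡⟨ cong suc (m≤n⇒∣m-n∣≡n∸m (spine-≤ v j v≡)) ⟩
        suc (n ∸ j)                           ∎)
      where
      open ≡-Reasoning
      last<m : 2 + n * 2 < m
      last<m = n<1+n _

-- Translation back to halves of the order and of the vertex label.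

k*2≡k+k : ∀ k → k * 2 ≡ k + k
k*2≡k+k k = trans (*-comm k 2) (cong (λ x → k + x) (+-identityʳ k))

folded-eccentricity : ∀ m → ¬ (2 ∣ m) → 3 ≤ m → (v : Fin m) → ¬ (2 ∣ toℕ v) →
  (toℕ v ≥ (m ∸ 1) / 2 → IsEccentricity (foldedComponent m) v ((toℕ v + 1) / 2))
  × (toℕ v < (m ∸ 1) / 2 → IsEccentricity (foldedComponent m) v ((m ∸ toℕ v) / 2))
folded-eccentricity m 2∤m 3≤m v 2∤v with odd⇒1+k*2 2∤m | odd⇒1+k*2 2∤v
... | zero  , refl | _ = contradiction 3≤m λ { (s≤s ()) }
... | suc n , refl | j , v≡ = high , low
  where
  G = foldedComponent (3 + n * 2)

  half : (2 + n * 2) / 2 ≡ suc n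
  half = m*n/n≡m (suc n) 2

  high : toℕ v ≥ (2 + n * 2) / 2 → IsEccentricity G v ((toℕ v + 1) / 2)
  high v≥ = subst (IsEccentricity G v) (sym (begin
      (toℕ v + 1) / 2      ≡⟨ cong (λ x → (x + 1) / 2) v≡ ⟩
      (1 + j * 2 + 1) / 2  ≡⟨ cong (_/ 2) (+-comm (1 + j * 2) 1) ⟩
      suc j * 2 / 2        ≡⟨ m*n/n≡m (suc j) 2 ⟩
      suc j                ∎))
    (eccentricity-high n v j v≡
      -- The threshold is n + 1 and v is 1 + 2j, so the case condition becomes n ≤ 2j.
      (subst (n ≤_) (k*2≡k+k j) (s≤s⁻¹ (subst₂ _≤_ half v≡ v≥))))
    where open ≡-Reasoning

  low : toℕ v < (2 + n * 2) / 2 → IsEccentricity G v ((3 + n * 2 ∸ toℕ v) / 2)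
  low v< = subst (IsEccentricity G v) (sym (begin
      (3 + n * 2 ∸ toℕ v) / 2  ≡⟨ cong (λ x → (3 + n * 2 ∸ x) / 2) v≡ ⟩
      (suc n * 2 ∸ j * 2) / 2  ≡⟨ cong (_/ 2) (*-distribʳ-∸ 2 (suc n) j) ⟨
      (suc n ∸ j) * 2 / 2      ≡⟨ m*n/n≡m (suc n ∸ j) 2 ⟩
      suc n ∸ j                ≡⟨ +-∸-assoc 1 (spine-≤ n v j v≡) ⟩
      suc (n ∸ j)              ∎))
    (eccentricity-low n v j v≡
      -- Likewise 1 + 2j < n + 1 gives 2j < n, weakened to 2j ≤ n.
      (subst (_≤ n) (k*2≡k+k j) (<⇒≤ (s<s⁻¹ (subst₂ _<_ v≡ half v<)))))
    where open ≡-Reasoning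

proposition25 : (p : ℕ) → Prime p → (p % 120 ≡ 71) ⊎ (p % 120 ≡ 119) →
    let open Ideals (𝓞 p) in
    (𝔩 : Ideal) → IsPrimeIdeal 𝔩 → (+ 2 , + 0) ∈ᴵ 𝔩 →
    (ord : ℕ) → IsClassOrder 𝔩 ord → ¬ (2 ∣ ord) → 3 ≤ ord →
    (v : Fin ord) → ¬ (2 ∣ toℕ v) →
    (toℕ v ≥ (ord ∸ 1) / 2 →
    IsEccentricity (foldedComponent ord) v ((toℕ v + 1) / 2))
    × (toℕ v < (ord ∸ 1) / 2 →
    IsEccentricity (foldedComponent ord) v ((ord ∸ toℕ v) / 2))
proposition25 _ _ _ _ _ _ ord _ 2∤ord 3≤ord = folded-eccentricity ord 2∤ord 3≤ord
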